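{- Let $c$ be a positive rational number, and let $A$ be an $\omega\times\omega$ matrix over $\mathbb Q$ whose rows are all possible rows (elements of $\mathbb Q^\omega$ with finitely many nonzero entries) whose entries have sum equal to $c$. Then $A$ is maximal IPR.
   Context: $\mathbb N=\{1,2,3,\ldots\}$, $\omega=\{0,1,2,\ldots\}$. All matrices have rational entries and only finitely many nonzero entries in each row. A matrix $A$ is image partition regular (IPR) if, whenever $\mathbb N$ is finitely coloured, there is a vector $\vec x$ with entries in $\mathbb N$ such that all entries of $A\vec x$ are natural numbers of the same colour. A matrix $A$ is maximal IPR provided it is IPR and, if $\vec r$ is a row (with rational entries) with finitely many nonzero entries which is not a row of $A$, then $\left(\begin{array}{c}\vec r\\ A\end{array}\right)$ is not IPR. -}

module Defs where

open import Data.Fin.Base using (Fin; toℕ)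
open import Data.Integer.Base using (+_)
open import Data.Nat.Base using (ℕ; zero; suc; _≤_; NonZero)
open import Data.Product.Base using (_×_; ∃-syntax)
open import Data.Rational.Base using (ℚ; 0ℚ; _*_; _/_)
open import Data.Rational.Properties using (+-0-commutativeMonoid)
open import Data.Refinement.Base using (Refinement-syntax; value)
open import Relation.Binary.PropositionalEquality.Core using (_≡_)
open import Relation.Nullary.Negation.Core using (¬_)

open import Algebra.Properties.CommutativeMonoid.Sum +-0-commutativeMonoid
  using (sum)

-- The positive integers {1,2,3,…}; ℕ itself is {0,1,2,…}, i.e. ω.
ℕ⁺ : Set
ℕ⁺ = [ n ∈ ℕ ∣ NonZero n ]

fromℕ⁺ : ℕ⁺ → ℚ
fromℕ⁺ n = + value n / 1

-- Elements of ℚ^ω with finitely many nonzero entries. The bound need not be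
-- optimal: it only says where the sums below may stop, and their values do
-- not depend on it.
record Row : Set where
  field
    entry     : ℕ → ℚ
    bound     : ℕ
    vanishing : ∀ j → bound ≤ j → entry j ≡ 0ℚ

open Row public

-- Equality of rows is entrywise, so `bound` and `vanishing` are ignored.
infix 4 _≈_
_≈_ : Row → Row → Set
r ≈ s = ∀ j → entry r j ≡ entry s j

entrySum : Row → ℚ
entrySum r = sum {bound r} (λ j → entry r (toℕ j))

infixl 7 _·_
_·_ : Row → (ℕ → ℕ⁺) → ℚ
r · x = sum {bound r} (λ j → entry r (toℕ j) * fromℕ⁺ (x (toℕ j)))

-- ω × ω matrices, all of whose rows have finite support.
Matrix : Set
Matrix = ℕ → Row

infix 4 _isRowOf_
_isRowOf_ : Row → Matrix → Set
r isRowOf A = ∃[ i ] A i ≈ r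

-- The matrix with r placed on top of A. Since 1 + ω = ω, its rows are again
-- indexed by ω.
infixr 5 _atop_
_atop_ : Row → Matrix → Matrix
(r atop A) zero    = r
(r atop A) (suc i) = A i

-- Image partition regularity; χ is a colouring with (at most) k colours.
IPR : Matrix → Set
IPR A = ∀ (k : ℕ) (χ : ℕ⁺ → Fin k) →
        ∃[ x ] ∃[ colour ] ∀ i →
        ∃[ n ] (A i · x ≡ fromℕ⁺ n) × (χ n ≡ colour)

MaximalIPR : Matrix → Set
MaximalIPR A = IPR A × (∀ r → ¬ (r isRowOf A) → ¬ IPR (r atop A))

-- The rows of A are exactly the rows with entry sum c, in any order and
-- possibly with repetitions.
RowsAreAllWithSum : ℚ → Matrix → Set
RowsAreAllWithSum c A = (∀ i → entrySum (A i) ≡ c) ×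
                        (∀ r → entrySum r ≡ c → r isRowOf A)

{-# OPTIONS --safe #-}

-- Regularity: the constant vector d, with d the denominator of c, makes every
-- entry of the image equal to the numerator of c.
--
-- Maximality: if x is not constant then some row with entry sum c is
-- orthogonal to x, so x must be a constant d and the image consists of c d
-- only. An extra row with entry sum s ≠ c contributes s d, so regularity would
-- forbid colouring ℕ⁺ such that n and q n always differ, where q = s / c ≠ 1.
-- Such a 2-colouring exists: for q > 1, alternate along the chains n, q n, q² n, …
module Submission where

open import Defs
open import Data.Fin.Base using (Fin; zero; suc; toℕ; opposite)
import Data.Integer.Base as ℤ
import Data.Integer.Properties as ℤ
open import Data.Irrelevant using ([_])
open import Data.Nat.Base as ℕ using (ℕ; zero; suc; z≤n; s≤s)
open import Data.Nat.Coprimality using (Coprime)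
open import Data.Nat.Divisibility using (_∣?_; divides)
import Data.Nat.Properties as ℕ
open import Data.Product.Base using (_×_; _,_; proj₁; proj₂; ∃-syntax)
open import Data.Rational.Base using (ℚ; mkℚ; 0ℚ; 1ℚ; _+_; _*_; _-_; -_; 1/_; _/_; _<_; *<*; toℚᵘ; ≢-nonZero)
open import Data.Rational.Properties
import Data.Rational.Unnormalised.Base as ℚᵘ
import Data.Rational.Unnormalised.Properties as ℚᵘ
open import Data.Rational.Solver using (module +-*-Solver)
open import Data.Refinement.Base using (value; _,_)
open import Function.Base using (_∘_; const)
open import Relation.Binary.Definitions using (tri<; tri≈; tri>)
open import Relation.Binary.PropositionalEquality
open import Relation.Nullary.Decidable.Core using (yes; no; decidable-stable)
open import Relation.Nullary.Negation.Core using (¬_; contradiction)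

open import Algebra.Bundles using (CommutativeRing)
open import Algebra.Properties.Group +-0-group using (x∙y⁻¹≈ε⇒x≈y)
open import Algebra.Properties.Semiring.Sum (CommutativeRing.semiring +-*-commutativeRing)
  using (sum; sum-cong-≗; *-distribʳ-sum)

-- Cancellation in ℚ, and rows acting on rational vectors

*-cancelʳ-≡-nonZero : ∀ {p q} r → r ≢ 0ℚ → p * r ≡ q * r → p ≡ q
*-cancelʳ-≡-nonZero {p} {q} r r≢0 eq = begin
  p                ≡⟨ cancel p ⟨
  p * r * 1/ r     ≡⟨ cong (_* 1/ r) eq ⟩
  q * r * 1/ r     ≡⟨ cancel q ⟩
  q                ∎
  where
  open ≡-Reasoning
  instance
    nonZero = ≢-nonZero r≢0

  cancel : ∀ t → t * r * 1/ r ≡ t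
  cancel t = trans (*-assoc t r (1/ r)) (trans (cong (t *_) (*-inverseʳ r)) (*-identityʳ t))

infixl 7 _∙_
-- `r · x` unfolds to `r ∙ (fromℕ⁺ ∘ x)`; rational vectors also admit shifted and all-ones vectors.
_∙_ : Row → (ℕ → ℚ) → ℚ
r ∙ y = sum {bound r} (λ j → entry r (toℕ j) * y (toℕ j))

-- Rows equal under `_≈_` may carry different bounds; this reconciles where their sums stop.
sum-bound-irrelevant : ∀ m n (f : ℕ → ℚ) →
                       (∀ j → m ℕ.≤ j → f j ≡ 0ℚ) → (∀ j → n ℕ.≤ j → f j ≡ 0ℚ) →
                       sum {m} (f ∘ toℕ) ≡ sum {n} (f ∘ toℕ)
sum-bound-irrelevant zero zero f _ _ = refl
sum-bound-irrelevant zero (suc n) f p q = sym (trans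
  (cong₂ _+_ (p 0 z≤n) (sym (sum-bound-irrelevant zero n (f ∘ suc) (λ j _ → p (suc j) z≤n) (λ j → q (suc j) ∘ s≤s))))
  (+-identityˡ 0ℚ))
sum-bound-irrelevant (suc m) zero f p q = trans
  (cong₂ _+_ (q 0 z≤n) (sum-bound-irrelevant m zero (f ∘ suc) (λ j → p (suc j) ∘ s≤s) (λ j _ → q (suc j) z≤n)))
  (+-identityˡ 0ℚ)
sum-bound-irrelevant (suc m) (suc n) f p q = cong (f 0 +_)
  (sum-bound-irrelevant m n (f ∘ suc) (λ j → p (suc j) ∘ s≤s) (λ j → q (suc j) ∘ s≤s))

∙-congˡ : ∀ r s y → r ≈ s → r ∙ y ≡ s ∙ y
∙-congˡ r s y r≈s = trans
  (sum-cong-≗ {bound r} (λ j → cong (_* y (toℕ j)) (r≈s (toℕ j))))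
  (sum-bound-irrelevant (bound r) (bound s) (λ j → entry s j * y j)
    (λ j r≤j → vanish j (trans (sym (r≈s j)) (vanishing r j r≤j)))
    (λ j s≤j → vanish j (vanishing s j s≤j)))
  where
  vanish : ∀ j → entry s j ≡ 0ℚ → entry s j * y j ≡ 0ℚ
  vanish j eq = trans (cong (_* y j) eq) (*-zeroˡ (y j))

∙-constant : ∀ r y q → (∀ j → y j ≡ q) → r ∙ y ≡ entrySum r * q
∙-constant r y q y≡q = trans
  (sum-cong-≗ {bound r} (λ j → cong (entry r (toℕ j) *_) (y≡q (toℕ j))))
  (sym (*-distribʳ-sum {bound r} q (entry r ∘ toℕ)))

-- Rows orthogonal to a non-constant vector

single : ℚ → ℕ → ℕ → ℚ
single t zero    zero    = t
single t zero    (suc j) = 0ℚ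
single t (suc i) zero    = 0ℚ
single t (suc i) (suc j) = single t i j

single-vanishing : ∀ t i j → i ℕ.< j → single t i j ≡ 0ℚ
single-vanishing t zero    (suc j) _         = refl
single-vanishing t (suc i) (suc j) (s≤s i<j) = single-vanishing t i j i<j

sum-single : ∀ t i (y : ℕ → ℚ) → sum {suc i} (λ j → single t i (toℕ j) * y (toℕ j)) ≡ t * y i
sum-single t zero    y = +-identityʳ (t * y 0)
sum-single t (suc i) y =
  trans (cong₂ _+_ (*-zeroˡ (y 0)) (sum-single t i (y ∘ suc))) (+-identityˡ (t * y (suc i)))

-- `b` stands in column `suc i`, so it never collides with `a` in column 0.
twoEntries : ℚ → ℚ → ℕ → Row
twoEntries a b i = record
  { entry     = λ { zero → a ; (suc j) → single b i j }
  ; bound     = suc (suc i)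
  ; vanishing = λ { (suc j) (s≤s i<j) → single-vanishing b i j i<j }
  }

twoEntries-∙ : ∀ a b i y → twoEntries a b i ∙ y ≡ a * y 0 + b * y (suc i)
twoEntries-∙ a b i y = cong (a * y 0 +_) (sum-single b i (y ∘ suc))

-- The entry sum is the product with the all-ones vector.
twoEntries-sum : ∀ a b i → entrySum (twoEntries a b i) ≡ a + b
twoEntries-sum a b i = begin
  entrySum r            ≡⟨ *-identityʳ (entrySum r) ⟨
  entrySum r * 1ℚ       ≡⟨ ∙-constant r (const 1ℚ) 1ℚ (λ _ → refl) ⟨
  r ∙ const 1ℚ          ≡⟨ twoEntries-∙ a b i (const 1ℚ) ⟩
  a * 1ℚ + b * 1ℚ       ≡⟨ cong₂ _+_ (*-identityʳ a) (*-identityʳ b) ⟩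
  a + b                 ∎
  where
  open ≡-Reasoning
  r = twoEntries a b i

-- Entries `y (suc i)` and `- y 0` in columns 0 and `suc i` annihilate `y`. Their sum `d` is
-- nonzero, so scaling by `c * 1/ d` makes it `c`.
orthogonal-row : ∀ c (y : ℕ → ℚ) i → y (suc i) ≢ y 0 →
                 ∃[ r ] (entrySum r ≡ c) × (r ∙ y ≡ 0ℚ)
orthogonal-row c y i yᵢ≢y₀ = r , sum≡c , orthogonal
  where
  open ≡-Reasoning
  open +-*-Solver
  d = y (suc i) - y 0

  instance
    d≢0 = ≢-nonZero {d} (yᵢ≢y₀ ∘ x∙y⁻¹≈ε⇒x≈y (y (suc i)) (y 0))

  u = c * 1/ d
  r = twoEntries (u * y (suc i)) (u * - y 0) i

  sum≡c : entrySum r ≡ c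
  sum≡c = begin
    entrySum r                   ≡⟨ twoEntries-sum (u * y (suc i)) (u * - y 0) i ⟩
    u * y (suc i) + u * - y 0    ≡⟨ *-distribˡ-+ u (y (suc i)) (- y 0) ⟨
    c * 1/ d * d                 ≡⟨ *-assoc c (1/ d) d ⟩
    c * (1/ d * d)               ≡⟨ cong (c *_) (*-inverseˡ d) ⟩
    c * 1ℚ                       ≡⟨ *-identityʳ c ⟩
    c                            ∎

  orthogonal : r ∙ y ≡ 0ℚ
  orthogonal = begin
    r ∙ y                                           ≡⟨ twoEntries-∙ (u * y (suc i)) (u * - y 0) i y ⟩
    u * y (suc i) * y 0 + u * - y 0 * y (suc i)     ≡⟨ solve 3 (λ u p q → u :* q :* p :+ u :* :- p :* q := con 0ℚ)
                                                               refl u (y 0) (y (suc i)) ⟩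
    0ℚ                                              ∎

-- Natural numbers inside ℚ

fromℕ : ℕ → ℚ
fromℕ n = ℤ.+ n / 1

fromℕ-injective : ∀ {m n} → fromℕ m ≡ fromℕ n → m ≡ n
fromℕ-injective {m} {n} eq with ℚᵘ.*≡* eq′ ← /-injective-≃ (ℚᵘ.mkℚᵘ (ℤ.+ m) 0) (ℚᵘ.mkℚᵘ (ℤ.+ n) 0) eq =
  ℤ.+-injective (ℤ.*-cancelʳ-≡ (ℤ.+ m) (ℤ.+ n) ℤ.1ℤ eq′)

toℚᵘ-fromℕ : ∀ n → toℚᵘ (fromℕ n) ℚᵘ.≃ ℚᵘ.mkℚᵘ (ℤ.+ n) 0
toℚᵘ-fromℕ n = toℚᵘ-fromℚᵘ (ℚᵘ.mkℚᵘ (ℤ.+ n) 0)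

-- `_/_` normalises its result, so the identity is checked on unnormalised fractions, where it is
-- integer arithmetic.
fromℕ-* : ∀ m n → fromℕ (m ℕ.* n) ≡ fromℕ m * fromℕ n
fromℕ-* m n = toℚᵘ-injective (begin
  toℚᵘ (fromℕ (m ℕ.* n))                             ≈⟨ toℚᵘ-fromℕ (m ℕ.* n) ⟩
  ℚᵘ.mkℚᵘ (ℤ.+ (m ℕ.* n)) 0                          ≈⟨ ℚᵘ.*≡* (cong (ℤ._* ℤ.1ℤ) (ℤ.pos-* m n)) ⟩
  ℚᵘ.mkℚᵘ (ℤ.+ m) 0 ℚᵘ.* ℚᵘ.mkℚᵘ (ℤ.+ n) 0           ≈⟨ ℚᵘ.*-cong (toℚᵘ-fromℕ m) (toℚᵘ-fromℕ n) ⟨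
  toℚᵘ (fromℕ m) ℚᵘ.* toℚᵘ (fromℕ n)                 ≈⟨ toℚᵘ-homo-* (fromℕ m) (fromℕ n) ⟨
  toℚᵘ (fromℕ m * fromℕ n)                           ∎)
  where open import Relation.Binary.Reasoning.Setoid ℚᵘ.≃-setoid

*-denominator : ∀ n d-1 .(coprime : Coprime n (suc d-1)) → mkℚ (ℤ.+ n) d-1 coprime * fromℕ (suc d-1) ≡ fromℕ n
*-denominator n d-1 coprime = toℚᵘ-injective (begin
  toℚᵘ (c * fromℕ (suc d-1))                         ≈⟨ toℚᵘ-homo-* c (fromℕ (suc d-1)) ⟩
  toℚᵘ c ℚᵘ.* toℚᵘ (fromℕ (suc d-1))                 ≈⟨ ℚᵘ.*-congˡ {toℚᵘ c} (toℚᵘ-fromℕ (suc d-1)) ⟩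
  ℚᵘ.mkℚᵘ (ℤ.+ n) d-1 ℚᵘ.* ℚᵘ.mkℚᵘ (ℤ.+ suc d-1) 0   ≈⟨ ℚᵘ.*≡* cross ⟩
  ℚᵘ.mkℚᵘ (ℤ.+ n) 0                                  ≈⟨ toℚᵘ-fromℕ n ⟨
  toℚᵘ (fromℕ n)                                     ∎)
  where
  open import Relation.Binary.Reasoning.Setoid ℚᵘ.≃-setoid
  c = mkℚ (ℤ.+ n) d-1 coprime

  cross : ℤ.+ n ℤ.* ℤ.+ suc d-1 ℤ.* ℤ.1ℤ ≡ ℤ.+ n ℤ.* ℤ.+ (suc d-1 ℕ.* 1)
  cross = trans (ℤ.*-identityʳ _) (cong (λ z → ℤ.+ n ℤ.* ℤ.+ z) (sym (ℕ.*-identityʳ (suc d-1))))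

value-nonZero : (n : ℕ⁺) → ℕ.NonZero (value n)
value-nonZero (suc n , _) = _
value-nonZero (zero , [ () ])

fromℕ⁺≢0 : ∀ n → fromℕ⁺ n ≢ 0ℚ
fromℕ⁺≢0 n eq = ℕ.≢-nonZero⁻¹ (value n) {{value-nonZero n}} (fromℕ-injective eq)

-- Two-colourings that separate numbers in a fixed ratio

opposite≢ : (i : Fin 2) → i ≢ opposite i
opposite≢ zero       ()
opposite≢ (suc zero) ()

module _ (a b : ℕ) .{{_ : ℕ.NonZero a}} .{{_ : ℕ.NonZero b}} (b<a : b ℕ.< a) where

  -- The first argument is fuel: n itself suffices, since n b = m a forces m < n.
  chainColour : ℕ → ℕ → Fin 2
  chainColour zero       n = zero
  chainColour (suc fuel) n with a ∣? n ℕ.* b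
  ... | yes (divides m _) = opposite (chainColour fuel m)
  ... | no  _             = zero

  predecessor-nonZero : ∀ {m} n .{{_ : ℕ.NonZero n}} → n ℕ.* b ≡ m ℕ.* a → ℕ.NonZero m
  predecessor-nonZero {m} n eq =
    ℕ.m*n≢0⇒m≢0 m {{subst ℕ.NonZero eq (ℕ.m*n≢0 n b)}}

  predecessor-< : ∀ {m} n .{{_ : ℕ.NonZero n}} → n ℕ.* b ≡ m ℕ.* a → m ℕ.< n
  predecessor-< {m} n eq =
    ℕ.*-cancelʳ-< a m n (subst (ℕ._< n ℕ.* a) eq (ℕ.*-monoʳ-< n b<a))

  -- The recursive call at `n` reaches the predecessor `m` with fuel one less than that for `n`,
  -- whereas the colour of `m` itself uses fuel `m`. Both are enough.
  chainColour-fuel : ∀ f g n .{{_ : ℕ.NonZero n}} → n ℕ.≤ f → n ℕ.≤ g →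
                     chainColour f n ≡ chainColour g n
  chainColour-fuel (suc f) (suc g) n n≤f n≤g with a ∣? n ℕ.* b
  ... | yes (divides m eq) = cong opposite
    (chainColour-fuel f g m {{predecessor-nonZero n eq}}
      (ℕ.≤-pred (ℕ.≤-trans (predecessor-< n eq) n≤f))
      (ℕ.≤-pred (ℕ.≤-trans (predecessor-< n eq) n≤g)))
  ... | no _ = refl
  chainColour-fuel zero    g    (suc n) () _
  chainColour-fuel (suc f) zero (suc n) _ ()

  -- The equation says that `n` follows `m` in a chain of ratio a/b, so the recursion at `n` flips
  -- the colour of `m`.
  chainColour-alternates : ∀ n m .{{_ : ℕ.NonZero n}} → n ℕ.* b ≡ m ℕ.* a →
                           chainColour n n ≡ opposite (chainColour m m)
  chainColour-alternates n@(suc f) m eq with a ∣? n ℕ.* b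
  ... | no ¬a∣nb = contradiction (divides m eq) ¬a∣nb
  -- Cancelling `a` identifies the quotient found by the divisibility test with `m`.
  ... | yes (divides m′ eq′) with refl ← ℕ.*-cancelʳ-≡ m′ m a (trans (sym eq′) eq) =
    cong opposite (chainColour-fuel f m m {{predecessor-nonZero n eq}}
      (ℕ.≤-pred (predecessor-< n eq)) ℕ.≤-refl)

ratio-colouring-> : ∀ a b .{{_ : ℕ.NonZero a}} .{{_ : ℕ.NonZero b}} → b ℕ.< a →
                    ∃[ χ ] ∀ (n m : ℕ⁺) → value n ℕ.* b ≡ value m ℕ.* a → χ n ≢ χ m
ratio-colouring-> a b b<a = χ , distinct
  where
  χ : ℕ⁺ → Fin 2
  χ n = chainColour a b b<a (value n) (value n)

  distinct : ∀ (n m : ℕ⁺) → value n ℕ.* b ≡ value m ℕ.* a → χ n ≢ χ m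
  distinct n m eq χn≡χm = opposite≢ (χ m) (trans (sym χn≡χm)
    (chainColour-alternates a b b<a (value n) (value m) {{value-nonZero n}} eq))

ratio-colouring : ∀ (a b : ℕ⁺) → value a ≢ value b →
                  ∃[ χ ] ∀ (n m : ℕ⁺) → value n ℕ.* value b ≡ value m ℕ.* value a → χ n ≢ χ m
ratio-colouring a b a≢b with ℕ.<-cmp (value a) (value b)
... | tri≈ _ a≡b _ = contradiction a≡b a≢b
... | tri> _ _ b<a = ratio-colouring-> (value a) (value b) {{value-nonZero a}} {{value-nonZero b}} b<a
-- For a ratio below 1 the chains are read backwards: `a` and `b` swap, and so do `n` and `m`.
... | tri< a<b _ _ =
  let χ , distinct = ratio-colouring-> (value b) (value a) {{value-nonZero b}} {{value-nonZero a}} a<b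
  in  χ , λ n m eq → distinct m n (sym eq) ∘ sym

-- Positive images under the matrix of all rows with sum `c`

module _ {c : ℚ} {A : Matrix} (rows : RowsAreAllWithSum c A) where

  positive-image⇒constant : ∀ x → (∀ i → ∃[ n ] A i · x ≡ fromℕ⁺ n) →
                            ∀ j → fromℕ⁺ (x j) ≡ fromℕ⁺ (x 0)
  positive-image⇒constant x image zero    = refl
  -- Equality in ℚ is decidable, so it suffices to refute inequality: the orthogonal row occurs in
  -- `A` and would put 0 into the image.
  positive-image⇒constant x image (suc j) = decidable-stable (_ ≟ _) λ xⱼ≢x₀ →
    let r , sum≡c , r∙x≡0 = orthogonal-row c (fromℕ⁺ ∘ x) j xⱼ≢x₀
        i , Aᵢ≈r          = proj₂ rows r sum≡c
        n , Aᵢ·x≡n        = image i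
    in  fromℕ⁺≢0 n (trans (sym Aᵢ·x≡n) (trans (∙-congˡ (A i) r (fromℕ⁺ ∘ x) Aᵢ≈r) r∙x≡0))

  atop-image : ∀ {r} → IPR (r atop A) → ∀ {k} (χ : ℕ⁺ → Fin k) →
               ∃[ a ] ∃[ b ] ∃[ d ] (entrySum r * fromℕ⁺ d ≡ fromℕ⁺ a) ×
                                    (c * fromℕ⁺ d ≡ fromℕ⁺ b) × (χ a ≡ χ b)
  atop-image {r} ipr {k} χ =
    let x , colour , image = ipr k χ
        -- Row 0 of `r atop A` is `r`; row 1 is `A 0`, which serves as a sample row of sum `c`.
        a , r·x≡a , χa     = image 0
        b , A₀·x≡b , χb    = image 1
        constant           = positive-image⇒constant x (λ i → let n , eq , _ = image (suc i) in n , eq)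
        scaled             = λ s → ∙-constant s (fromℕ⁺ ∘ x) (fromℕ⁺ (x 0)) constant
    in  a , b , x 0
      , trans (sym (scaled r)) r·x≡a
      , trans (cong (_* fromℕ⁺ (x 0)) (sym (proj₁ rows 0))) (trans (sym (scaled (A 0))) A₀·x≡b)
      , trans χa (sym χb)

-- Regularity and maximality

constant-row-sums⇒IPR : ∀ {c} → 0ℚ < c → ∀ A → (∀ i → entrySum (A i) ≡ c) → IPR A
constant-row-sums⇒IPR {mkℚ (ℤ.+ suc n) d-1 coprime} _ A sums k χ =
  const d , χ m , λ i → m , image i , refl
  where
  m d : ℕ⁺
  m = suc n , [ _ ]
  d = suc d-1 , [ _ ]

  image : ∀ i → A i · const d ≡ fromℕ⁺ m
  image i = begin
    A i · const d                                ≡⟨ ∙-constant (A i) (const (fromℕ⁺ d)) (fromℕ⁺ d) (λ _ → refl) ⟩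
    entrySum (A i) * fromℕ⁺ d                    ≡⟨ cong (_* fromℕ⁺ d) (sums i) ⟩
    mkℚ (ℤ.+ suc n) d-1 coprime * fromℕ⁺ d       ≡⟨ *-denominator (suc n) d-1 coprime ⟩
    fromℕ⁺ m                                     ∎
    where open ≡-Reasoning
constant-row-sums⇒IPR {mkℚ (ℤ.+ zero)   _ _} (*<* (ℤ.+<+ ()))
constant-row-sums⇒IPR {mkℚ ℤ.-[1+ _ ] _ _} (*<* ())

-- Both a/b and a′/b′ equal s/c. Different colourings may yield different constants `d` and `d′`,
-- but the ratio persists; it is cross-multiplied to fit `ratio-colouring`.
scaled-proportional : ∀ s c (a b d a′ b′ d′ : ℕ⁺) →
                      s * fromℕ⁺ d ≡ fromℕ⁺ a → c * fromℕ⁺ d ≡ fromℕ⁺ b →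
                      s * fromℕ⁺ d′ ≡ fromℕ⁺ a′ → c * fromℕ⁺ d′ ≡ fromℕ⁺ b′ →
                      value a′ ℕ.* value b ≡ value b′ ℕ.* value a
scaled-proportional s c a b d a′ b′ d′ sd cd sd′ cd′ = fromℕ-injective (begin
  fromℕ (value a′ ℕ.* value b)          ≡⟨ fromℕ-* (value a′) (value b) ⟩
  fromℕ⁺ a′ * fromℕ⁺ b                  ≡⟨ cong₂ _*_ sd′ cd ⟨
  s * fromℕ⁺ d′ * (c * fromℕ⁺ d)        ≡⟨ solve 4 (λ s c d d′ → s :* d′ :* (c :* d) := c :* d′ :* (s :* d))
                                              refl s c (fromℕ⁺ d) (fromℕ⁺ d′) ⟩
  c * fromℕ⁺ d′ * (s * fromℕ⁺ d)        ≡⟨ cong₂ _*_ cd′ sd ⟩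
  fromℕ⁺ b′ * fromℕ⁺ a                  ≡⟨ fromℕ-* (value b′) (value a) ⟨
  fromℕ (value b′ ℕ.* value a)          ∎)
  where
  open ≡-Reasoning
  open +-*-Solver

proposition3p2 : (c : ℚ) → 0ℚ < c → (A : Matrix) → RowsAreAllWithSum c A → MaximalIPR A
proposition3p2 c 0<c A rows = constant-row-sums⇒IPR 0<c A (proj₁ rows) , maximal
  where
  maximal : ∀ r → ¬ (r isRowOf A) → ¬ IPR (r atop A)
  maximal r r∉A ipr =
    let -- The trivial colouring already exhibits entrySum r / c as a ratio a / b of positive integers.
        a , b , d , sd , cd , _            = atop-image rows {r} ipr {1} (const zero)
        χ , distinct                       = ratio-colouring a b (a≢b a b d sd cd)
        -- Regularity is used a second time, now against the colouring built from a/b: the new pair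
        -- has that same ratio, yet equal colours.
        a′ , b′ , d′ , sd′ , cd′ , χa′≡χb′ = atop-image rows {r} ipr χ
    in  distinct a′ b′ (scaled-proportional (entrySum r) c a b d a′ b′ d′ sd cd sd′ cd′) χa′≡χb′
    where
    -- If the values agreed, cancelling `d` would give `r` entry sum `c`, making it a row of `A`.
    a≢b : ∀ a b d → entrySum r * fromℕ⁺ d ≡ fromℕ⁺ a → c * fromℕ⁺ d ≡ fromℕ⁺ b → value a ≢ value b
    a≢b a b d sd cd a≡b = r∉A (proj₂ rows r
      (*-cancelʳ-≡-nonZero (fromℕ⁺ d) (fromℕ⁺≢0 d) (trans sd (trans (cong fromℕ a≡b) (sym cd)))))
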